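{- Let $H$ be a hypergraph. If Avoider (resp. Enforcer) wins on $H$ as last player, then Avoider (resp. Enforcer) also wins on $H$ as second-to-last player.
   Context: A hypergraph $H$ has a finite vertex set $V(H)$ and an edge set $E(H)\subseteq 2^{V(H)}$ (the empty edge is allowed). In the Avoider-Enforcer game on $H$, two players, Avoider and Enforcer, alternately pick one previously unpicked vertex of $H$ until all vertices have been picked. Enforcer wins if at the end Avoider has picked all the vertices of some edge of $H$; otherwise Avoider wins (in particular Enforcer wins if $\varnothing\in E(H)$). The last player is the player who makes the last move of the game: this is the first player if $|V(H)|$ is odd and the second player if $|V(H)|$ is even; the other player is the second-to-last player. A player "wins on $H$ as last (resp. second-to-last) player" if that player has a winning strategy for the game on $H$ when they are the last (resp. second-to-last) player. -}

module Defs where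

open import Data.Bool.Base using (if_then_else_)
open import Data.Fin.Base using (Fin)
open import Data.Fin.Subset using (Subset; _⊆_; _∪_; ⁅_⁆; ⊥)
open import Data.Nat.Base using (ℕ; zero; suc; _<_; parity)
open import Data.Parity.Base using (0ℙ; 1ℙ)
open import Data.Product.Base using (∃; ∃-syntax; _×_)
open import Data.Vec.Base using (Vec; []; _∷_)
open import Data.Vec.Membership.Propositional using (_∉_)
open import Data.Vec.Relation.Unary.Unique.Propositional using (Unique)
open import Level using (0ℓ)
open import Relation.Binary.Definitions using (DecidableEquality)
open import Relation.Binary.PropositionalEquality using (_≡_; _≢_; refl)
open import Relation.Nullary using (¬_; does; yes; no)
open import Relation.Unary using (Pred; Decidable)

-- The edge set is an arbitrary subset of the power set of the vertices.
-- Decidability is the constructive reading of "set of edges" for a finite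
-- hypergraph.
record Hypergraph : Set₁ where
  field
    order : ℕ
    Edge  : Pred (Subset order) 0ℓ
    edge? : Decidable Edge

  Vertex : Set
  Vertex = Fin order

open Hypergraph public

data Player : Set where
  avoider enforcer : Player

_≟_ : DecidableEquality Player
avoider  ≟ avoider  = yes refl
avoider  ≟ enforcer = no λ ()
enforcer ≟ avoider  = no λ ()
enforcer ≟ enforcer = yes refl

opponent : Player → Player
opponent avoider  = enforcer
opponent enforcer = avoider

-- turn f k is the player to move once k moves have been made, when f
-- moves first.
turn : Player → ℕ → Player
turn f zero    = f
turn f (suc k) = opponent (turn f k)

lastPlayer : Hypergraph → Player → Player
lastPlayer H f with parity (order H)
... | 1ℙ = f
... | 0ℙ = opponent f

-- The vertices picked so far, by both players, most recent first.
History : Hypergraph → ℕ → Set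
History H k = Vec (Vertex H) k

picks : ∀ {H k} → Player → Player → History H k → Subset (order H)
picks         f p []      = ⊥
picks {H} {suc k} f p (v ∷ h) =
  if does (turn f k ≟ p) then ⁅ v ⁆ ∪ picks {H} f p h else picks {H} f p h

Won : (H : Hypergraph) (first : Player) → Player → History H (order H) → Set
Won H f enforcer h = ∃[ e ] Edge H e × e ⊆ picks {H} f avoider h
Won H f avoider  h = ¬ Won H f enforcer h

-- The value of move matters only at histories without repetition at which
-- it is p's turn. Elsewhere it is unconstrained. The bound k < order H is
-- irrelevant, so that a move depends on the history alone.
record Strategy (H : Hypergraph) (first p : Player) : Set where
  field
    move  : ∀ {k} → History H k → .(k < order H) → Vertex H
    legal : ∀ {k} (h : History H k) .(k<n : k < order H) →
            Unique h → turn first k ≡ p → move h k<n ∉ h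

open Strategy public

-- The histories that can arise when p plays according to σ and the
-- opponent makes arbitrary legal moves.
data Follows {H f p} (σ : Strategy H f p) : ∀ {k} → History H k → Set where
  start    : Follows σ []
  own      : ∀ {k} {h : History H k} {v} .(k<n : k < order H) →
             Follows σ h → turn f k ≡ p → v ≡ move σ h k<n →
             Follows σ (v ∷ h)
  opposing : ∀ {k} {h : History H k} {v} →
             Follows σ h → turn f k ≢ p → v ∉ h →
             Follows σ (v ∷ h)

Winning : ∀ {H f p} → Strategy H f p → Set
Winning {H} {f} {p} σ =
  (h : History H (order H)) → Follows σ h → Won H f p h

HasWinningStrategy : Hypergraph → (first : Player) → Player → Set
HasWinningStrategy H f p = ∃ λ (σ : Strategy H f p) → Winning σ

-- In both definitions the first player f is determined by the condition on
-- lastPlayer, so the quantifier over f ranges over exactly one player.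
WinsAsLast : Hypergraph → Player → Set
WinsAsLast H p = ∃[ f ] lastPlayer H f ≡ p × HasWinningStrategy H f p

WinsAsSecondToLast : Hypergraph → Player → Set
WinsAsSecondToLast H p =
  ∃[ f ] lastPlayer H f ≡ opponent p × HasWinningStrategy H f p

{-# OPTIONS --safe #-}

-- Strategy stealing with a phantom vertex. Let p win as last player. As
-- second-to-last player, p plays the same strategy in an imagined game with
-- the same picks except for one vertex x, which is unpicked in the real game
-- but already picked in the imagined one. If the number of vertices is odd, x
-- is p's own imagined first pick; if it is even, x is an arbitrary imagined
-- first pick of the opponent. If the opponent really picks x mid-game, the
-- number of unpicked vertices is even and a new phantom is imagined for the
-- opponent. At the end the opponent has to pick the phantom, which is at
-- least as good for p as the imagined outcome.
module Submission where

open import Defs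
open import Data.Bool.Base using (if_then_else_)
open import Data.Fin.Base using (Fin; zero; suc)
open import Data.Fin.Properties using (any?; all?) renaming (_≟_ to _≟ᶠ_)
open import Data.Fin.Subset
  using (Subset; inside; outside; _∈_; _⊆_; _∪_; ⁅_⁆; ⊤; _-_; ∣_∣; Nonempty)
open import Data.Fin.Subset.Properties
open import Data.Nat.Base using (ℕ; zero; suc; _+_; _∸_; _≤_; _<_; z≤n; s≤s; parity)
open import Data.Nat.Properties
  using (≤-reflexive; ≤-trans; ≤-antisym; n≤1+n; n≮0; +-suc; +-identityʳ; m≤n+m;
         +-monoʳ-≤; +-cancelˡ-≤; m+n∸n≡m; suc-injective; _<?_)
open import Data.Parity.Base using (0ℙ; 1ℙ)
open import Data.Product.Base using (∃-syntax; _×_; _,_; proj₁; proj₂)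
open import Data.Sum.Base using (inj₁; inj₂)
open import Data.Vec.Base using (Vec; []; _∷_; here; there)
open import Data.Vec.Membership.Propositional using (_∉_)
open import Data.Vec.Relation.Unary.All using (All; []; _∷_)
open import Data.Vec.Relation.Unary.Any using (here; there)
open import Data.Vec.Relation.Unary.Unique.Propositional using (Unique; []; _∷_)
open import Function.Base using (_∘_; id)
open import Relation.Binary.PropositionalEquality
  using (_≡_; _≢_; refl; sym; trans; cong; subst; subst₂; module ≡-Reasoning)
open import Relation.Nullary using (Dec; does; yes; no; ¬_; contradiction)
open import Relation.Nullary.Decidable using (¬?; _×-dec_; _→-dec_; recompute)

-- Players, parity and sizes of subsets

opponent-involutive : ∀ p → opponent (opponent p) ≡ p
opponent-involutive avoider  = refl
opponent-involutive enforcer = refl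

opponent≢ : ∀ p → opponent p ≢ p
opponent≢ avoider  ()
opponent≢ enforcer ()

≢⇒≡opponent : ∀ {t p} → t ≢ p → t ≡ opponent p
≢⇒≡opponent {avoider}  {avoider}  t≢p = contradiction refl t≢p
≢⇒≡opponent {avoider}  {enforcer} t≢p = refl
≢⇒≡opponent {enforcer} {avoider}  t≢p = refl
≢⇒≡opponent {enforcer} {enforcer} t≢p = contradiction refl t≢p

opponent≡⇒≡opponent : ∀ {t p} → opponent t ≡ p → t ≡ opponent p
opponent≡⇒≡opponent {t} refl = sym (opponent-involutive t)

opponent-injective : ∀ {t p} → opponent t ≡ opponent p → t ≡ p
opponent-injective {p = p} eq = trans (opponent≡⇒≡opponent eq) (opponent-involutive p)

∉⇒All≢ : ∀ {A : Set} {k x} (xs : Vec A k) → x ∉ xs → All (x ≢_) xs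
∉⇒All≢ []       x∉ = []
∉⇒All≢ (y ∷ ys) x∉ = x∉ ∘ here ∷ ∉⇒All≢ ys (x∉ ∘ there)

parity-pred : ∀ n → parity (suc n) ≡ 1ℙ → parity n ≡ 0ℙ
parity-pred zero          odd = refl
parity-pred (suc (suc n)) odd = parity-pred n odd

∣p∣≤1+∣p-x∣ : ∀ {n} (p : Subset n) x → ∣ p ∣ ≤ suc ∣ p - x ∣
∣p∣≤1+∣p-x∣ (inside  ∷ p) zero    = s≤s (≤-reflexive (cong ∣_∣ (sym (p─⊥≡p p))))
∣p∣≤1+∣p-x∣ (outside ∷ p) zero    = ≤-trans (n≤1+n _) (s≤s (≤-reflexive (cong ∣_∣ (sym (p─⊥≡p p)))))
∣p∣≤1+∣p-x∣ (inside  ∷ p) (suc x) = s≤s (∣p∣≤1+∣p-x∣ p x)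
∣p∣≤1+∣p-x∣ (outside ∷ p) (suc x) = ∣p∣≤1+∣p-x∣ p x

∣p-x∣≡ : ∀ {n r x} {p : Subset n} → ∣ p ∣ ≡ suc r → x ∈ p → ∣ p - x ∣ ≡ r
∣p-x∣≡ {x = x} {p} eq x∈p = suc-injective (trans
  (≤-antisym (x∈p⇒∣p-x∣<∣p∣ x∈p) (∣p∣≤1+∣p-x∣ p x)) eq)

0<∣p∣⇒Nonempty : ∀ {n} {p : Subset n} → 0 < ∣ p ∣ → Nonempty p
0<∣p∣⇒Nonempty {n} {p} 0<∣p∣ with nonempty? p
... | yes ne = ne
... | no ¬ne = contradiction
  (subst (0 <_) (trans (cong ∣_∣ (Empty-unique ¬ne)) (∣⊥∣≡0 n)) 0<∣p∣) n≮0

∣p∣≡0⇒Empty : ∀ {n x} {p : Subset n} → ∣ p ∣ ≡ 0 → ¬ x ∈ p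
∣p∣≡0⇒Empty eq x∈p = n≮0 (≤-trans (x∈p⇒∣p-x∣<∣p∣ x∈p) (≤-reflexive eq))

x∉p-x : ∀ {n} (p : Subset n) x → ¬ x ∈ p - x
x∉p-x (inside  ∷ p) zero ()
x∉p-x (outside ∷ p) zero ()
x∉p-x (_ ∷ p) (suc x) (there x∈) = x∉p-x p x x∈

x∈p-y⇒x≢y : ∀ {n x y} {p : Subset n} → x ∈ p - y → x ≢ y
x∈p-y⇒x≢y {p = p} x∈p-y refl = x∉p-x p _ x∈p-y

x∈p-y⇒x∈p : ∀ {n x y} {p : Subset n} → x ∈ p - y → x ∈ p
x∈p-y⇒x∈p {y = y} {p} = p─q⊆p p ⁅ y ⁆

∪-swap : ∀ {n} (p q r : Subset n) → p ∪ (q ∪ r) ≡ q ∪ (p ∪ r)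
∪-swap p q r = begin
  p ∪ (q ∪ r)  ≡⟨ ∪-assoc p q r ⟨
  (p ∪ q) ∪ r  ≡⟨ cong (_∪ r) (∪-comm p q) ⟩
  (q ∪ p) ∪ r  ≡⟨ ∪-assoc q p r ⟩
  q ∪ (p ∪ r)  ∎
  where open ≡-Reasoning

∪-monoʳ : ∀ {n} (p : Subset n) {q r} → q ⊆ r → p ∪ q ⊆ p ∪ r
∪-monoʳ p {q} q⊆r x∈ with x∈p∪q⁻ p q x∈
... | inj₁ x∈p = x∈p∪q⁺ (inj₁ x∈p)
... | inj₂ x∈q = x∈p∪q⁺ (inj₂ (q⊆r x∈q))

-- Comparing Avoider's picks

-- The effect on Avoider's picks of t picking v, in the form used by picks.
claim : ∀ {n} → Player → Fin n → Subset n → Subset n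
claim t v A = if does (t ≟ avoider) then ⁅ v ⁆ ∪ A else A

claim-comm : ∀ {n} s t (x y : Fin n) A → claim s x (claim t y A) ≡ claim t y (claim s x A)
claim-comm avoider  avoider  x y A = ∪-swap ⁅ x ⁆ ⁅ y ⁆ A
claim-comm avoider  enforcer x y A = refl
claim-comm enforcer avoider  x y A = refl
claim-comm enforcer enforcer x y A = refl

-- A ⊑[ p ] B: for p it is at least as good that Avoider holds B as A.
_⊑[_]_ : ∀ {n} → Subset n → Player → Subset n → Set
A ⊑[ avoider  ] B = B ⊆ A
A ⊑[ enforcer ] B = A ⊆ B

claim-mono : ∀ {n} p t (v : Fin n) {A B} → A ⊑[ p ] B → claim t v A ⊑[ p ] claim t v B
claim-mono avoider  avoider  v A⊑B = ∪-monoʳ ⁅ v ⁆ A⊑B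
claim-mono avoider  enforcer v A⊑B = A⊑B
claim-mono enforcer avoider  v A⊑B = ∪-monoʳ ⁅ v ⁆ A⊑B
claim-mono enforcer enforcer v A⊑B = A⊑B

-- Holding a vertex never helps: it can only hurt Avoider, and Enforcer can only gain if Avoider has
-- it.
claim-opponent : ∀ {n} p (v : Fin n) A → claim p v A ⊑[ p ] claim (opponent p) v A
claim-opponent avoider  v A = q⊆p∪q ⁅ v ⁆ A
claim-opponent enforcer v A = q⊆p∪q ⁅ v ⁆ A

-- Outcomes and backward induction

module _ (H : Hypergraph) where

  Outcome : Player → Subset (order H) → Set
  Outcome enforcer A = ∃[ e ] Edge H e × e ⊆ A
  Outcome avoider  A = ¬ Outcome enforcer A

  outcome? : ∀ p A → Dec (Outcome p A)
  outcome? enforcer A = anySubset? λ e → edge? H e ×-dec e ⊆? A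
  outcome? avoider  A = ¬? (outcome? enforcer A)

  outcome-mono : ∀ p {A B} → A ⊑[ p ] B → Outcome p A → Outcome p B
  outcome-mono enforcer A⊆B (e , edge , e⊆A) = e , edge , A⊆B ∘ e⊆A
  outcome-mono avoider  B⊆A ¬won won = ¬won (outcome-mono enforcer B⊆A won)

  outcome⇒won : ∀ {f} p (h : History H (order H)) → Outcome p (picks {H} f avoider h) → Won H f p h
  outcome⇒won avoider  h = id
  outcome⇒won enforcer h = id

  won⇒outcome : ∀ {f} p (h : History H (order H)) → Won H f p h → Outcome p (picks {H} f avoider h)
  won⇒outcome avoider  h = id
  won⇒outcome enforcer h = id

  module _ (p : Player) where

    -- p wins with p (resp. the opponent) to move when r moves are left,
    -- Avoider holds A, and U is the set of unpicked vertices.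
    Moving Waiting : ℕ → (A U : Subset (order H)) → Set
    Moving zero    A U = Outcome p A
    Moving (suc r) A U = ∃[ v ] v ∈ U × Waiting r (claim p v A) (U - v)
    Waiting zero    A U = Outcome p A
    Waiting (suc r) A U = ∀ v → v ∈ U → Moving r (claim (opponent p) v A) (U - v)

    moving?  : ∀ r A U → Dec (Moving r A U)
    waiting? : ∀ r A U → Dec (Waiting r A U)
    moving? zero    A U = outcome? p A
    moving? (suc r) A U = any? λ v → v ∈? U ×-dec waiting? r (claim p v A) (U - v)
    waiting? zero    A U = outcome? p A
    waiting? (suc r) A U = all? λ v → v ∈? U →-dec moving? r (claim (opponent p) v A) (U - v)

    moving-mono  : ∀ r {A B U} → A ⊑[ p ] B → Moving r A U → Moving r B U
    waiting-mono : ∀ r {A B U} → A ⊑[ p ] B → Waiting r A U → Waiting r B U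
    moving-mono zero    A⊑B w = outcome-mono p A⊑B w
    moving-mono (suc r) A⊑B (v , v∈U , w) = v , v∈U , waiting-mono r (claim-mono p p v A⊑B) w
    waiting-mono zero    A⊑B w = outcome-mono p A⊑B w
    waiting-mono (suc r) A⊑B w v v∈U = moving-mono r (claim-mono p (opponent p) v A⊑B) (w v v∈U)

    -- The phantom argument

    -- In the first two lemmas x is the phantom.
    waiting-phantom : ∀ r {A U x} → parity r ≡ 0ℙ → ∣ U ∣ ≡ suc r → x ∈ U →
      Waiting r (claim (opponent p) x A) (U - x) → Waiting (suc r) A U
    moving-phantom : ∀ r {A U x} → parity r ≡ 0ℙ → ∣ U ∣ ≡ suc (suc r) → x ∈ U →
      Moving (suc r) (claim (opponent p) x A) (U - x) → Moving (suc (suc r)) A U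
    waiting⇒moving : ∀ r {A U} → parity r ≡ 0ℙ → ∣ U ∣ ≡ r → Waiting r A U → Moving r A U

    waiting-phantom r {x = x} even eq x∈U w y y∈U with y ≟ᶠ x
    -- The opponent really picks the phantom: both games now have the same picks, but `p` is to move
    -- in the real one.
    waiting-phantom r {x = x} even eq x∈U w y y∈U | yes refl =
      waiting⇒moving r even (∣p-x∣≡ eq x∈U) w
    -- Only the phantom is left, and as `r` is even it is the opponent who must take it.
    waiting-phantom zero even eq x∈U w y y∈U | no y≢x =
      contradiction (x∈p∧x≢y⇒x∈p-y y∈U y≢x) (∣p∣≡0⇒Empty (∣p-x∣≡ eq x∈U))
    -- The pick `y` is copied into the imagined game; the order of the claims on `x` and `y` is
    -- immaterial.
    waiting-phantom (suc (suc r)) {A} {U} {x} even eq x∈U w y y∈U | no y≢x =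
      moving-phantom r even (∣p-x∣≡ eq y∈U) (x∈p∧x≢y⇒x∈p-y x∈U (y≢x ∘ sym))
        (subst₂ (Moving (suc r))
          (claim-comm (opponent p) (opponent p) y x A) (p─x─y≡p─y─x U x y)
          (w y (x∈p∧x≢y⇒x∈p-y y∈U y≢x)))

    -- The imagined reply `v` is available in the real game and differs from `x`, so the phantom
    -- survives.
    moving-phantom r {A} {U} {x} even eq x∈U (v , v∈U-x , w) =
      v , v∈U , waiting-phantom r even (∣p-x∣≡ eq v∈U)
        (x∈p∧x≢y⇒x∈p-y x∈U (x∈p-y⇒x≢y v∈U-x ∘ sym))
        (subst₂ (Waiting r) (claim-comm p (opponent p) v x A) (p─x─y≡p─y─x U x v) w)
      where v∈U = x∈p-y⇒x∈p v∈U-x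

    waiting⇒moving zero          even eq w = w
    -- An arbitrary unpicked `x`, imagined as the opponent's pick, becomes the phantom.
    waiting⇒moving (suc (suc r)) even eq w
      with x , x∈U ← 0<∣p∣⇒Nonempty (subst (0 <_) (sym eq) (s≤s z≤n)) =
      moving-phantom r even eq x∈U (w x x∈U)

    -- The imagined winning pick `v` of `p` becomes the phantom; handing it to the opponent instead
    -- is at least as good for `p`.
    moving⇒waiting : ∀ r {A U} → parity r ≡ 1ℙ → ∣ U ∣ ≡ r → Moving r A U → Waiting r A U
    moving⇒waiting (suc r) odd eq (v , v∈U , w) =
      waiting-phantom r (parity-pred r odd) eq v∈U
        (waiting-mono r (claim-opponent p v _) w)

    -- Choosing the vertex in every nonempty position, winning or not, makes
    -- the strategy below total.
    reply : ∀ r A U → Nonempty U →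
      ∃[ v ] v ∈ U × (Moving (suc r) A U → Waiting r (claim p v A) (U - v))
    reply r A U (x , x∈U) with moving? (suc r) A U
    ... | yes (v , v∈U , w) = v , v∈U , λ _ → w
    ... | no ¬m             = x , x∈U , λ m → contradiction m ¬m

    Winnable : Player → ℕ → (A U : Subset (order H)) → Set
    Winnable t r A U = (t ≡ p → Moving r A U) × (t ≡ opponent p → Waiting r A U)

    winnable-end : ∀ {t A U} → Winnable t 0 A U → Outcome p A
    winnable-end {t} (m , w) with t ≟ p
    ... | yes t≡p = m t≡p
    ... | no  t≢p = w (≢⇒≡opponent t≢p)

  -- Histories and unpicked vertices

  unpicked : ∀ {k} → History H k → Subset (order H)
  unpicked []      = ⊤
  unpicked (v ∷ h) = unpicked h - v

  ∈unpicked⇒∉ : ∀ {k v} (h : History H k) → v ∈ unpicked h → v ∉ h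
  ∈unpicked⇒∉ (x ∷ h) v∈ (here v≡x)  = x∈p-y⇒x≢y v∈ v≡x
  ∈unpicked⇒∉ (x ∷ h) v∈ (there v∈h) = ∈unpicked⇒∉ h (x∈p-y⇒x∈p v∈) v∈h

  ∉⇒∈unpicked : ∀ {k v} (h : History H k) → v ∉ h → v ∈ unpicked h
  ∉⇒∈unpicked []      v∉h = ∈⊤
  ∉⇒∈unpicked (x ∷ h) v∉h = x∈p∧x≢y⇒x∈p-y (∉⇒∈unpicked h (v∉h ∘ there)) (v∉h ∘ here)

  -- Each entry removes at most one vertex; equality fails when `h` has repetitions.
  order≤k+∣unpicked∣ : ∀ {k} (h : History H k) → order H ≤ k + ∣ unpicked h ∣
  order≤k+∣unpicked∣ []              = ≤-reflexive (sym (∣⊤∣≡n (order H)))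
  order≤k+∣unpicked∣ {suc k} (v ∷ h) = ≤-trans (order≤k+∣unpicked∣ h)
    (≤-trans (+-monoʳ-≤ k (∣p∣≤1+∣p-x∣ (unpicked h) v)) (≤-reflexive (+-suc k _)))

  unpicked-nonempty : ∀ {k} (h : History H k) → k < order H → Nonempty (unpicked h)
  unpicked-nonempty {k} h k<n = 0<∣p∣⇒Nonempty (+-cancelˡ-≤ k 1 _
    (≤-trans (≤-reflexive (trans (+-suc k 0) (cong suc (+-identityʳ k))))
      (≤-trans k<n (order≤k+∣unpicked∣ h))))

  -- Translation between strategies and backward induction

  module _ {f p : Player} where

    -- The position reached by h, with r moves left.
    WinnableAt : ∀ {k} → ℕ → History H k → Set
    WinnableAt {k} r h = Winnable p (turn f k) r (picks {H} f avoider h) (unpicked h)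

    -- Needed to invoke `legal`, which covers only histories without repetition.
    follows-unique : ∀ {k} {h : History H k} (σ : Strategy H f p) → Follows σ h → Unique h
    follows-unique σ start = []
    follows-unique σ (own {h = h} k<n fol t≡p refl) =
      ∉⇒All≢ h (legal σ h k<n unique t≡p) ∷ unique
      where unique = follows-unique σ fol
    follows-unique σ (opposing {h = h} fol t≢p v∉h) = ∉⇒All≢ h v∉h ∷ follows-unique σ fol

    module _ (σ : Strategy H f p) (winning : Winning σ) where

      follows-moving  : ∀ r {k} {h : History H k} → r + k ≡ order H → turn f k ≡ p →
        Follows σ h → Moving p r (picks {H} f avoider h) (unpicked h)
      follows-waiting : ∀ r {k} {h : History H k} → r + k ≡ order H → turn f k ≡ opponent p →
        Follows σ h → Waiting p r (picks {H} f avoider h) (unpicked h)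
      follows-moving zero {h = h} refl t≡p fol = won⇒outcome p h (winning h fol)
      follows-moving (suc r) {k} {h} eq t≡p fol =
        v , ∉⇒∈unpicked h (legal σ h k<n (follows-unique σ fol) t≡p) ,
        -- `picks` unfolds to a claim by `turn f k`, which `t≡p` identifies with `p`.
        subst (λ t → Waiting p r (claim t v (picks {H} f avoider h)) (unpicked h - v)) t≡p
          (follows-waiting r (trans (+-suc r k) eq) (cong opponent t≡p)
            (own k<n fol t≡p refl))
        where
        k<n : k < order H
        k<n = subst (k <_) eq (s≤s (m≤n+m k r))
        v = move σ h k<n
      follows-waiting zero {h = h} refl t≡o fol = won⇒outcome p h (winning h fol)
      follows-waiting (suc r) {k} {h} eq t≡o fol v v∈ =
        subst (λ t → Moving p r (claim t v (picks {H} f avoider h)) (unpicked h - v)) t≡o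
          (follows-moving r (trans (+-suc r k) eq)
            (trans (cong opponent t≡o) (opponent-involutive p))
            (opposing fol (λ t≡p → opponent≢ p (trans (sym t≡o) t≡p)) (∈unpicked⇒∉ h v∈)))

    hasWinningStrategy⇒winnable : HasWinningStrategy H f p → WinnableAt (order H) []
    hasWinningStrategy⇒winnable (σ , winning) =
      (λ t≡p → follows-moving σ winning (order H) (+-identityʳ _) t≡p start) ,
      (λ t≡o → follows-waiting σ winning (order H) (+-identityʳ _) t≡o start)

    replyAt : ∀ {k} (h : History H k) → .(k < order H) → _
    replyAt {k} h k<n = reply p (order H ∸ suc k) (picks {H} f avoider h) (unpicked h)
      -- The irrelevant bound is recovered by deciding it.
      (unpicked-nonempty h (recompute (k <? order H) k<n))

    replyStrategy : Strategy H f p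
    replyStrategy = record
      { move  = λ h k<n → proj₁ (replyAt h k<n)
      ; legal = λ h k<n _ _ → ∈unpicked⇒∉ h (proj₁ (proj₂ (replyAt h k<n)))
      }

    -- Induction along the play: `reply` keeps a winning position winning, and `Waiting` covers
    -- every pick of the opponent.
    follows-winnable : WinnableAt (order H) [] → ∀ {k} {h : History H k} → Follows replyStrategy h →
      ∀ r → r + k ≡ order H → WinnableAt r h
    follows-winnable win start r eq =
      subst (λ r → WinnableAt r []) (trans (sym eq) (+-identityʳ r)) win
    follows-winnable win {suc k} (own {h = h} {v} k<n fol t≡p refl) r eq =
      (λ o≡p → contradiction (trans (cong opponent (sym t≡p)) o≡p) (opponent≢ p)) ,
      (λ _ → subst (λ t → Waiting p r (claim t v (picks {H} f avoider h)) (unpicked h - v)) (sym t≡p)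
        (subst (λ r → Moving p (suc r) (picks {H} f avoider h) (unpicked h) →
                      Waiting p r (claim p v (picks {H} f avoider h)) (unpicked h - v))
          -- `replyAt` counts the moves left after its pick as `order H ∸ suc k`, which is `r`.
          (trans (cong (_∸ suc k) (sym eq)) (m+n∸n≡m r (suc k)))
          (proj₂ (proj₂ (replyAt h k<n)))
          (proj₁ (follows-winnable win fol (suc r) (trans (sym (+-suc r k)) eq)) t≡p)))
    follows-winnable win {suc k} (opposing {h = h} {v} fol t≢p v∉h) r eq =
      (λ _ → subst (λ t → Moving p r (claim t v (picks {H} f avoider h)) (unpicked h - v)) (sym t≡o)
        (proj₂ (follows-winnable win fol (suc r) (trans (sym (+-suc r k)) eq)) t≡o
          v (∉⇒∈unpicked h v∉h))) ,
      (λ o≡o → contradiction (opponent-injective o≡o) t≢p)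
      where t≡o = ≢⇒≡opponent t≢p

    winnable⇒hasWinningStrategy : WinnableAt (order H) [] → HasWinningStrategy H f p
    winnable⇒hasWinningStrategy win = replyStrategy , λ h fol →
      outcome⇒won p h (winnable-end p {U = unpicked h} (follows-winnable win fol 0 refl))

theorem2p2 : (H : Hypergraph) (p : Player) → WinsAsLast H p → WinsAsSecondToLast H p
theorem2p2 H p (f , last , win) with parity (order H) in eq
-- Odd order: the last player starts, so `p` moves first in the given game and second in the new
-- one.
... | 1ℙ = opponent p , refl , winnable⇒hasWinningStrategy H
  ( (λ o≡p → contradiction o≡p (opponent≢ p))
  , (λ _ → moving⇒waiting H p (order H) eq (∣⊤∣≡n (order H))
      (proj₁ (hasWinningStrategy⇒winnable H win) last)))
-- Even order: `p` moves second in the given game and first in the new one.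
... | 0ℙ = p , refl , winnable⇒hasWinningStrategy H
  ( (λ _ → waiting⇒moving H p (order H) eq (∣⊤∣≡n (order H))
      (proj₂ (hasWinningStrategy⇒winnable H win) (opponent≡⇒≡opponent last)))
  , (λ p≡o → contradiction (sym p≡o) (opponent≢ p)))
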